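{- Let $P$ be a standard, range-restricted logic program in which, whenever a variable $X$ occurs both in a term of the head and in a term of the body of a rule, at most one of these two terms is complex, and every complex term has nesting depth at most one. Then: (1) every argument in $\mathit{GA}(P)$ is limited; (2) if $P$ is $\Gamma$-acyclic, then $P$ is finitely ground.
   Context: Terms are constants, variables (simple terms) or $f(t_1,\dots,t_m)$ with $f$ a function symbol of arity $m$ (complex terms). An atom is $p(t_1,\dots,t_n)$. A standard rule has the form $A\leftarrow B_1,\dots,B_k$ ($k\ge 0$, all atoms); a standard program is a finite set of such rules; range-restricted means every head variable occurs in the body. Predicates are base (defined only by ground facts) or derived. For an $n$-ary predicate $p$, $p[i]$ ($1\le i\le n$) is its $i$-th argument; $args(P)$ is the set of all arguments. A standard program has a unique minimum model $M$; the active domain of $p[i]$ is $AD(p[i])=\{t_i\mid p(t_1,\dots,t_n)\in M\}$, and $p[i]$ is limited iff $AD(p[i])$ is finite. Depth: for a simple term $u$ occurring in $t$, $d(u,u)=0$ and $d(u,f(t_1,\dots,t_m))=1+\max_{i:\,t_i\text{ contains }u}d(u,t_i)$. Restricted arguments: for a function $\phi:args(P)\to\mathbb N$ define $\Omega(\phi)(p[i])=\max(\max\{D(r,i,X)\},0)$, the inner max over rules $r\in P$ with head $p(t_1,\dots,t_n)$ and variables $X$ occurring in $t_i$, where $D(r,i,X)=\min\{d(X,t_i)-d(X,u_j)+\phi(q[j])\mid q(u_1,\dots,u_m)\text{ a body atom of }r,\ X\text{ occurs in }u_j\}$. Let $\phi_0\equiv 0$. The sequence $\Omega^k(\phi_0)(p[i])$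 is nondecreasing in $k$; $AR(P)$ is the set of arguments $p[i]$ for which this sequence is eventually constant. Labeled argument graph $\mathcal G_L(P)$: nodes $args(P)$; for every rule $r$ with head $p(v_1,\dots,v_n)$, body atom $q(u_1,\dots,u_m)$, and a variable $X$ common to $u_j$ and $v_i$, there is an edge $(q[j],p[i],\alpha)$ with $\alpha=\epsilon$ if $u_j=v_i=X$; $\alpha=f$ if $u_j=X$ and $v_i=f(\dots,X,\dots)$; $\alpha=\overline f$ if $u_j=f(\dots,X,\dots)$ and $v_i=X$. For a path $\pi$ (nonempty sequence of consecutive edges), $\lambda(\pi)$ is the concatenation of its labels ($\epsilon$ is the empty string); $\pi$ spells $\lambda(\pi)$. Let $F_P$ be the set of function symbols of $P$, $\overline F_P=\{\overline f\mid f\in F_P\}$. The grammar $\Gamma_P$ has terminals $F_P\cup\overline F_P$, nonterminals $S,S_1,S_2$, start $S$, and productions $S\to S_1 f S_2$, $S_1\to f S_1\overline f S_1\mid\epsilon$, $S_2\to S_1S_2\mid fS_2\mid\epsilon$ for all $f\in F_P$; $\mathcal L(\Gamma_P)$ is its language. The propagation graph $\Delta(P)$ is $\mathcal G_L(P)$ with all edges ending in a node of $AR(P)$ removed. A node $a$ depends on a node $b$ if there is a path from $b$ to $a$; it depends on a cyclic path if it depends on some node of it (nodes on the cycle depend on it). $\mathit{GA}(P)$ is the set of arguments not depending on any cyclic path of $\Delta(P)$ spelling a string of $\mathcal L(\Gamma_P)$; $P$ is $\Gamma$-acyclic iff $\mathit{GA}(P)=args(P)$. Finitely ground (Calimeri,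 Cozza, Ianni, Leone 2008): $P$ is finitely ground if, for every topological ordering of the components of its predicate dependency graph, the intelligent instantiation of $P$ along that ordering (processing components in order, and for each component iteratively adding exactly those ground instances of its rules whose body atoms have already been derived as heads of previously added ground rules or facts) is finite; this instantiation has the same stable models as $P$. -}

module Defs where

open import Data.Nat using (ℕ; zero; suc; _≤_; _<_; _⊔_; _≡ᵇ_)
open import Data.Integer as ℤ using (ℤ; +_; _-_; ∣_∣)
open import Data.Bool using (Bool; true; false; if_then_else_; _∨_; _∧_)
open import Data.List using (List; []; _∷_; _++_; map; concatMap; length; foldr)
open import Data.List.Relation.Unary.All using (All)
open import Data.List.Relation.Unary.Any using (Any)
open import Data.List.Membership.Propositional using (_∈_)
open import Data.Maybe using (Maybe; just; nothing)
open import Data.Product using (_×_; _,_; Σ; ∃; ∃-syntax)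
open import Data.Sum using (_⊎_)
open import Relation.Nullary using (¬_)
open import Relation.Binary.PropositionalEquality using (_≡_)
open import Relation.Binary.Construct.Closure.ReflexiveTransitive using (Star)
open import Function.Bundles using (_⇔_)

data Term : Set where
  var : ℕ → Term
  con : ℕ → Term
  app : ℕ → List Term → Term

-- A function symbol is identified by its name together with its arity.
FSym : Set
FSym = ℕ × ℕ

-- A predicate symbol is identified by its name together with its arity.
PSym : Set
PSym = ℕ × ℕ

record Atom : Set where
  constructor atom
  field
    pred : ℕ
    args : List Term
open Atom public

psym : Atom → PSym
psym a = pred a , length (args a)

record Rule : Set where
  constructor _⇐_
  field
    head : Atom
    body : List Atom
open Rule public

Program : Set
Program = List Rule

data Simple : Term → Set where
  svar : ∀ {x} → Simple (var x)
  scon : ∀ {c} → Simple (con c)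

data Complex : Term → Set where
  capp : ∀ {f ts} → Complex (app f ts)

data Ground : Term → Set where
  gcon : ∀ {c} → Ground (con c)
  gapp : ∀ {f ts} → All Ground ts → Ground (app f ts)

data _⊑_ : Term → Term → Set where
  ⊑-refl : ∀ {t} → t ⊑ t
  ⊑-sub  : ∀ {s t f ts} → t ∈ ts → s ⊑ t → s ⊑ app f ts

mutual
  occ : ℕ → Term → Bool
  occ x (var y) = x ≡ᵇ y
  occ x (con c) = false
  occ x (app f ts) = occL x ts

  occL : ℕ → List Term → Bool
  occL x [] = false
  occL x (t ∷ ts) = occ x t ∨ occL x ts

mutual
  -- d(X,t) for a variable X occurring in t
  dep : ℕ → Term → ℕ
  dep x (var y) = 0
  dep x (con c) = 0
  dep x (app f ts) = suc (depL x ts)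

  depL : ℕ → List Term → ℕ
  depL x [] = 0
  depL x (t ∷ ts) = (if occ x t then dep x t else 0) ⊔ depL x ts

mutual
  varsT : Term → List ℕ
  varsT (var x) = x ∷ []
  varsT (con c) = []
  varsT (app f ts) = varsL ts

  varsL : List Term → List ℕ
  varsL [] = []
  varsL (t ∷ ts) = varsT t ++ varsL ts

mutual
  subT : (ℕ → Term) → Term → Term
  subT σ (var x) = σ x
  subT σ (con c) = con c
  subT σ (app f ts) = app f (subL σ ts)

  subL : (ℕ → Term) → List Term → List Term
  subL σ [] = []
  subL σ (t ∷ ts) = subT σ t ∷ subL σ ts

subA : (ℕ → Term) → Atom → Atom
subA σ (atom p ts) = atom p (subL σ ts)

subR : (ℕ → Term) → Rule → Rule
subR σ (h ⇐ bs) = subA σ h ⇐ map (subA σ) bs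

GroundSubst : (ℕ → Term) → Set
GroundSubst σ = ∀ x → Ground (σ x)

nth : {A : Set} → List A → ℕ → Maybe A
nth [] i = nothing
nth (a ∷ as) zero = just a
nth (a ∷ as) (suc i) = nth as i

OccA : ℕ → Atom → Set
OccA x a = Any (λ t → occ x t ≡ true) (args a)

RangeRestricted : Program → Set
RangeRestricted P = ∀ {r} → r ∈ P → ∀ x → OccA x (head r) → Any (OccA x) (body r)

AtMostOneComplex : Program → Set
AtMostOneComplex P = ∀ {r} → r ∈ P → ∀ {t b u} → t ∈ args (head r) → b ∈ body r → u ∈ args b →
  ∀ x → occ x t ≡ true → occ x u ≡ true → ¬ (Complex t × Complex u)

TermOf : Program → Term → Set
TermOf P s = ∃[ r ] (r ∈ P × ∃[ a ] (a ∈ (head r ∷ body r) × ∃[ t ] (t ∈ args a × s ⊑ t)))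

DepthAtMostOne : Program → Set
DepthAtMostOne P = ∀ {f ts} → TermOf P (app f ts) → All Simple ts

-- p[i] : predicate name, arity, position (0-based: position i+1 of the paper is ix = i)
record Arg : Set where
  constructor arg
  field
    nm ar ix : ℕ
open Arg public

IsArg : Program → Arg → Set
IsArg P (arg p n i) = ∃[ r ] (r ∈ P × ∃[ a ] (a ∈ (head r ∷ body r) × psym a ≡ (p , n))) × i < n

-- minimum model of a standard program (least set closed under ground instances of rules)
data M (P : Program) : Atom → Set where
  derive : ∀ {r} (σ : ℕ → Term) → r ∈ P → GroundSubst σ →
           All (M P) (map (subA σ) (body r)) → M P (subA σ (head r))

InAD : Program → Arg → Term → Set
InAD P (arg p n i) t = ∃[ a ] (M P a × psym a ≡ (p , n) × nth (args a) i ≡ just t)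

Limited : Program → Arg → Set
Limited P q = ∃[ L ] (∀ t → InAD P q t → t ∈ L)

indexed : {A : Set} → ℕ → List A → List (ℕ × A)
indexed k [] = []
indexed k (a ∷ as) = (k , a) ∷ indexed (suc k) as

bodyArgs : Rule → List (Arg × Term)
bodyArgs r = concatMap (λ b → map (λ { (j , u) → arg (pred b) (length (args b)) j , u })
                                  (indexed 0 (args b)))
                       (body r)

minZ : List ℤ → Maybe ℤ
minZ [] = nothing
minZ (z ∷ zs) with minZ zs
... | nothing = just z
... | just m = just (z ℤ.⊓ m)

maybeList : {A : Set} → Maybe A → List A
maybeList nothing = []
maybeList (just a) = a ∷ []

-- D(r,i,X) for the head term t_i (nothing if there is no body occurrence of X)
Dval : (Arg → ℕ) → Rule → Term → ℕ → Maybe ℤ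
Dval φ r ti x = minZ (concatMap (λ { (q , u) →
   if occ x u then (((+ dep x ti) - (+ dep x u)) ℤ.+ (+ φ q)) ∷ [] else [] }) (bodyArgs r))

headTerm : Rule → Arg → List Term
headTerm r (arg p n i) =
  if (pred (head r) ≡ᵇ p) ∧ (length (args (head r)) ≡ᵇ n) then maybeList (nth (args (head r)) i) else []

Ω : Program → (Arg → ℕ) → Arg → ℕ
Ω P φ a = ∣ foldr ℤ._⊔_ (+ 0)
   (concatMap (λ r → concatMap (λ ti → concatMap (λ x → maybeList (Dval φ r ti x)) (varsT ti))
                               (headTerm r a)) P) ∣

Ωiter : Program → ℕ → Arg → ℕ
Ωiter P zero = λ _ → 0
Ωiter P (suc k) = Ω P (Ωiter P k)

AR : Program → Arg → Set
AR P a = ∃[ k ] (∀ k′ → k ≤ k′ → Ωiter P k′ a ≡ Ωiter P k a)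

data Letter : Set where
  fw : FSym → Letter
  bw : FSym → Letter

-- edge labels: nothing = ε
Label : Set
Label = Maybe Letter

lab : Label → List Letter
lab nothing = []
lab (just c) = c ∷ []

data EdgeKind (x : ℕ) : Term → Term → Label → Set where
  eps : EdgeKind x (var x) (var x) nothing
  fwd : ∀ {f ts} → var x ∈ ts → EdgeKind x (var x) (app f ts) (just (fw (f , length ts)))
  bwd : ∀ {f ts} → var x ∈ ts → EdgeKind x (app f ts) (var x) (just (bw (f , length ts)))

data Edge (P : Program) : Arg → Arg → Label → Set where
  edge : ∀ {r b j i u v x α} → r ∈ P → b ∈ body r →
         nth (args b) j ≡ just u → nth (args (head r)) i ≡ just v → EdgeKind x u v α →
         Edge P (arg (pred b) (length (args b)) j)
                (arg (pred (head r)) (length (args (head r))) i) α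

FP : Program → FSym → Set
FP P (f , m) = ∃[ ts ] (length ts ≡ m × TermOf P (app f ts))

data S₁ (P : Program) : List Letter → Set where
  s₁ε : S₁ P []
  s₁f : ∀ {f x y} → FP P f → S₁ P x → S₁ P y → S₁ P (fw f ∷ x ++ bw f ∷ y)

data S₂ (P : Program) : List Letter → Set where
  s₂ε : S₂ P []
  s₂S : ∀ {x y} → S₁ P x → S₂ P y → S₂ P (x ++ y)
  s₂f : ∀ {f y} → FP P f → S₂ P y → S₂ P (fw f ∷ y)

data LΓ (P : Program) : List Letter → Set where
  sS : ∀ {x f y} → S₁ P x → FP P f → S₂ P y → LΓ P (x ++ fw f ∷ y)

ΔEdge : Program → Arg → Arg → Label → Set
ΔEdge P a b α = Edge P a b α × ¬ AR P b

module _ (E : Arg → Arg → Label → Set) where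
  data Path : Arg → Arg → List Letter → Set where
    one  : ∀ {a b α} → E a b α → Path a b (lab α)
    more : ∀ {a b c α w} → E a b α → Path b c w → Path a c (lab α ++ w)

  data OnPath (x : Arg) : ∀ {a c w} → Path a c w → Set where
    src1  : ∀ {b α} (e : E x b α) → OnPath x (one e)
    tgt1  : ∀ {a α} (e : E a x α) → OnPath x (one e)
    srcM  : ∀ {b c α w} (e : E x b α) (p : Path b c w) → OnPath x (more e p)
    there : ∀ {a b c α w} (e : E a b α) {p : Path b c w} → OnPath x p → OnPath x (more e p)

  Step : Arg → Arg → Set
  Step a b = ∃[ α ] E a b α

DependsOnBadCycle : Program → Arg → Set
DependsOnBadCycle P x =
  ∃[ c ] ∃[ w ] Σ (Path (ΔEdge P) c c w) λ π →
    LΓ P w × ∃[ b ] (OnPath (ΔEdge P) b π × Star (Step (ΔEdge P)) b x)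

GA : Program → Arg → Set
GA P x = IsArg P x × ¬ DependsOnBadCycle P x

ΓAcyclic : Program → Set
ΓAcyclic P = ∀ x → IsArg P x → GA P x

PDep : Program → PSym → PSym → Set
PDep P q p = ∃[ r ] (r ∈ P × psym (head r) ≡ p × Any (λ b → psym b ≡ q) (body r))

PredOf : Program → PSym → Set
PredOf P p = ∃[ r ] (r ∈ P × ∃[ a ] (a ∈ (head r ∷ body r) × psym a ≡ p))

-- a topological ordering of the components (SCCs) of the dependency graph,
-- given as the position ord p of the component of each predicate p
TopOrder : Program → (PSym → ℕ) → Set
TopOrder P ord =
  (∀ p q → PredOf P p → PredOf P q →
     (ord p ≡ ord q) ⇔ (Star (PDep P) p q × Star (PDep P) q p)) ×
  (∀ p q → PDep P q p → ord q ≤ ord p)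

-- intelligent instantiation of P along ord: a ground instance of a rule is added
-- (while processing the component of its head) once all its body atoms are heads of
-- previously added ground rules (of earlier components or of the same component)
data Inst (P : Program) (ord : PSym → ℕ) : Rule → Set where
  add : ∀ {r} (σ : ℕ → Term) → r ∈ P → GroundSubst σ →
        All (λ b → ∃[ g ] (Inst P ord g × head g ≡ b × ord (psym b) ≤ ord (psym (head r))))
            (body (subR σ r)) →
        Inst P ord (subR σ r)

FinitelyGround : Program → Set
FinitelyGround P = ∀ ord → TopOrder P ord → ∃[ L ] (∀ g → Inst P ord g → g ∈ L)

{-# OPTIONS --safe #-}
module Submission where

-- Let n be the number of arguments of P. Finite limits of Ω leave no gap, as Ω moves
-- values by at most one per step, so a restricted argument has limit < n, while the
-- iterates of Ω bound the heights of derivable terms up to 1. Read a branch of a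
-- derivable term as a stack pushed and popped along the labelled edges of its
-- derivation: while the stack is taller than n + 1 all edges used lie in Δ(P), and if
-- it grows by more than n beyond that, two of the last pushes start at the same node,
-- which closes a cycle spelling a word of the form f S₂. Otherwise heights are bounded
-- by 2n + 1, which leaves finitely many terms, atoms and rule instances. AR(P) is not
-- evidently decidable, but the height bound is, so AR(P) is decided under ¬¬ only.

open import Defs
open import Data.Bool using (true; false; if_then_else_; _∧_)
open import Data.Bool.Properties using (T-≡; ∨-zeroʳ)
open import Data.Empty using (⊥-elim)
open import Data.Fin as Fin using (Fin; toℕ)
import Data.Fin.Properties as Finₚ
open import Data.Integer as ℤ using (ℤ; +_; _-_)
import Data.Integer.Properties as ℤₚ
open import Data.Integer.Tactic.RingSolver using (solve-∀)
open import Data.List using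
  (List; []; _∷_; _++_; map; concatMap; foldr; length; lookup; replicate; upTo;
   cartesianProductWith)
open import Data.List.Extrema.Nat using (max; xs≤max)
open import Data.List.Membership.Propositional using (_∈_; find; lose)
open import Data.List.Membership.Propositional.Properties using
  (∈-concatMap⁺; ∈-concatMap⁻; ∈-map⁺; ∈-map⁻; ∈-upTo⁺; ∈-++⁺ˡ; ∈-++⁺ʳ; ∈-++⁻;
   ∈-cartesianProductWith⁺; ∈-lookup)
open import Data.List.Properties using (++-assoc; ++-identityʳ)
open import Data.List.Relation.Unary.All as All using (All; []; _∷_)
open import Data.List.Relation.Unary.AllPairs using (AllPairs; []; _∷_)
open import Data.List.Relation.Unary.Any as Any using (Any; here; there)
open import Data.List.Relation.Unary.Any.Properties using (lookup-index)
open import Data.Maybe using (just; nothing)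
open import Data.Nat using
  (ℕ; zero; suc; _+_; _⊔_; _≤_; _<_; _≡ᵇ_; _≤?_; _≟_; z≤n; s≤s; s≤s⁻¹; _≤′_; ≤′-refl;
   ≤′-step)
open import Data.Nat.Properties
open import Data.Product using (_×_; _,_; ∃-syntax; ∃₂; proj₁; proj₂)
open import Data.Sum using (_⊎_; inj₁; inj₂; [_,_]′)
open import Function using (_∘_; flip)
open import Function.Bundles using (Equivalence)
open import Relation.Binary.Construct.Closure.ReflexiveTransitive using (Star; ε; _◅_)
open import Relation.Binary.Definitions using (tri<; tri≈; tri>)
open import Relation.Binary.PropositionalEquality using (_≡_; _≢_; refl; sym; trans; cong; subst)
open import Relation.Nullary using (¬_; yes; no)
open import Relation.Nullary.Decidable.Core using (¬¬-excluded-middle)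

-- List positions, pigeonhole, and common stages under double negation

≡ᵇ-refl : ∀ n → (n ≡ᵇ n) ≡ true
≡ᵇ-refl zero = refl
≡ᵇ-refl (suc n) = ≡ᵇ-refl n

≡ᵇ-true : ∀ {m n} → (m ≡ᵇ n) ≡ true → m ≡ n
≡ᵇ-true {m} {n} eq = ≡ᵇ⇒≡ m n (Equivalence.from T-≡ eq)

nth-< : ∀ {A : Set} {a : A} as i → nth as i ≡ just a → i < length as
nth-< (_ ∷ as) zero    eq = s≤s z≤n
nth-< (_ ∷ as) (suc i) eq = s≤s (nth-< as i eq)

nth-∈ : ∀ {A : Set} {a : A} as i → nth as i ≡ just a → a ∈ as
nth-∈ (_ ∷ as) zero    refl = here refl
nth-∈ (_ ∷ as) (suc i) eq   = there (nth-∈ as i eq)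

∈-nth : ∀ {A : Set} {a : A} {as} → a ∈ as → ∃[ i ] nth as i ≡ just a
∈-nth (here refl) = zero , refl
∈-nth (there m) with i , eq ← ∈-nth m = suc i , eq

∈-maybeList-nth : ∀ {A : Set} {a : A} as i → a ∈ maybeList (nth as i) → a ∈ as
∈-maybeList-nth (_ ∷ as) zero    (here refl) = here refl
∈-maybeList-nth (_ ∷ as) (suc i) m           = there (∈-maybeList-nth as i m)

just⇒∈ : ∀ {A : Set} {a : A} {m} → m ≡ just a → a ∈ maybeList m
just⇒∈ refl = here refl

indexed⁺ : ∀ {A : Set} {a : A} k as i → nth as i ≡ just a → (k + i , a) ∈ indexed k as
indexed⁺ k (_ ∷ as) zero refl rewrite +-identityʳ k = here refl
indexed⁺ k (_ ∷ as) (suc i) eq rewrite +-suc k i = there (indexed⁺ (suc k) as i eq)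

indexed⁻ : ∀ {A : Set} {a : A} {j} k as → (j , a) ∈ indexed k as → ∃[ i ] (j ≡ k + i × nth as i ≡ just a)
indexed⁻ k (_ ∷ as) (here refl) = zero , sym (+-identityʳ k) , refl
indexed⁻ k (_ ∷ as) (there m) with i , refl , eq ← indexed⁻ (suc k) as m = suc i , sym (+-suc k i) , eq

pigeonhole-∈ : ∀ {A : Set} {m} (xs : List A) (g : Fin m → A) → (∀ i → g i ∈ xs) → length xs < m →
               ∃₂ λ i j → i Fin.< j × g i ≡ g j
pigeonhole-∈ xs g g∈ lt with i , j , i<j , eq ← Finₚ.pigeonhole lt (λ i → Any.index (g∈ i)) =
  i , j , i<j , trans (lookup-index (g∈ i)) (trans (cong (lookup xs) eq) (sym (lookup-index (g∈ j))))

-- If all levels below `length xs` were taken, one element for each of them together with `a`, whose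
-- level is higher, would be pairwise distinct and one too many for `xs`.
missing-level : ∀ {A : Set} (ψ : A → ℕ) (xs : List A) {a} → a ∈ xs → length xs ≤ ψ a →
                ∃[ v ] (v < ψ a × (∀ {b} → b ∈ xs → ψ b ≢ v))
missing-level {A} ψ xs {a} a∈ n≤ with
  Finₚ.¬∀⟶∃¬ (length xs) (λ v → Any (λ b → ψ b ≡ toℕ v) xs) (λ v → Any.any? (λ b → ψ b ≟ toℕ v) xs) not-all
  where
  not-all : ¬ (∀ v → Any (λ b → ψ b ≡ toℕ v) xs)
  not-all hits = go (pigeonhole-∈ xs node node-∈ ≤-refl)
    where
    node : Fin (suc (length xs)) → A
    node Fin.zero = a
    node (Fin.suc v) = proj₁ (find (hits v))
    node-∈ : ∀ i → node i ∈ xs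
    node-∈ Fin.zero = a∈
    node-∈ (Fin.suc v) = proj₁ (proj₂ (find (hits v)))
    level : ∀ v → ψ (node (Fin.suc v)) ≡ toℕ v
    level v = proj₂ (proj₂ (find (hits v)))
    go : ¬ (∃₂ λ i j → i Fin.< j × node i ≡ node j)
    go (Fin.zero , Fin.suc v , _ , eq) =
      <⇒≱ (Finₚ.toℕ<n v) (≤-trans n≤ (≤-reflexive (trans (cong ψ eq) (level v))))
    go (Fin.suc u , Fin.suc v , s≤s u<v , eq) =
      <⇒≢ u<v (trans (sym (level u)) (trans (cong ψ eq) (level v)))
... | v , unhit = toℕ v , <-≤-trans (Finₚ.toℕ<n v) n≤ , λ b∈ eq → unhit (lose b∈ eq)

-- The finitely many stages are joined by maximum, which is harmless because `Q` is monotone in the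
-- stage.
eventually : ∀ {A : Set} {Q : ℕ → A → Set} → (∀ {K K′ x} → K ≤ K′ → Q K x → Q K′ x) →
             (xs : List A) → (∀ {x} → x ∈ xs → ¬ ¬ (∃[ K ] Q K x)) →
             ¬ ¬ (∃[ K ] (∀ {x} → x ∈ xs → Q K x))
eventually up [] each k = k (0 , λ ())
eventually up (x ∷ xs) each k =
  each (here refl) λ { (K , q) → eventually up xs (each ∘ there) λ { (K′ , qs) →
    k (K ⊔ K′ , λ { (here refl) → up (m≤m⊔n K K′) q ; (there m) → up (m≤n⊔m K K′) (qs m) }) } }

-- Induction on the bound: a stage with value `suc B` would be a maximum, and if there is none the
-- bound drops to `B`. Such a stage cannot be searched for, hence the double negation.
bounded⇒attains-max : (f : ℕ → ℕ) (B : ℕ) → (∀ k → f k ≤ B) → ¬ ¬ (∃[ K ] (∀ k → f k ≤ f K))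
bounded⇒attains-max f zero    f≤ none = none (0 , λ k → ≤-trans (f≤ k) z≤n)
bounded⇒attains-max f (suc B) f≤ none = bounded⇒attains-max f B f≤B none
  where
  f≤B : ∀ k → f k ≤ B
  f≤B k with f k ≟ suc B
  ... | yes eq = ⊥-elim (none (k , λ k′ → subst (f k′ ≤_) (sym eq) (f≤ k′)))
  ... | no neq = s≤s⁻¹ (≤∧≢⇒< (f≤ k) neq)

-- Terms and substitutions

mutual
  height : Term → ℕ
  height (var _)    = 0
  height (con _)    = 0
  height (app _ ts) = suc (heightL ts)

  heightL : List Term → ℕ
  heightL []       = 0
  heightL (t ∷ ts) = height t ⊔ heightL ts

height-∈ : ∀ {t ts} → t ∈ ts → height t ≤ heightL ts
height-∈ {ts = t ∷ ts} (here refl) = m≤m⊔n _ _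
height-∈ {ts = t ∷ ts} (there m)   = ≤-trans (height-∈ m) (m≤n⊔m (height t) _)

heightL-≤ : ∀ {ts m} → (∀ {t} → t ∈ ts → height t ≤ m) → heightL ts ≤ m
heightL-≤ {[]}     h = z≤n
heightL-≤ {t ∷ ts} h = ⊔-lub (h (here refl)) (heightL-≤ (h ∘ there))

mutual
  varsT⇒occ : ∀ {x} t → x ∈ varsT t → occ x t ≡ true
  varsT⇒occ (var y)    (here refl) = ≡ᵇ-refl y
  varsT⇒occ (app f ts) m           = varsL⇒occ ts m

  varsL⇒occ : ∀ {x} ts → x ∈ varsL ts → occL x ts ≡ true
  varsL⇒occ {x} (t ∷ ts) m with ∈-++⁻ (varsT t) m
  ... | inj₁ m′ rewrite varsT⇒occ t m′ = refl
  ... | inj₂ m′ rewrite varsL⇒occ ts m′ = ∨-zeroʳ (occ x t)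

mutual
  occ⇒varsT : ∀ {x} t → occ x t ≡ true → x ∈ varsT t
  occ⇒varsT (var y)    eq = here (≡ᵇ-true eq)
  occ⇒varsT (app f ts) eq = occ⇒varsL ts eq

  occ⇒varsL : ∀ {x} ts → occL x ts ≡ true → x ∈ varsL ts
  occ⇒varsL {x} (t ∷ ts) eq with occ x t in o
  ... | true  = ∈-++⁺ˡ (occ⇒varsT t o)
  ... | false = ∈-++⁺ʳ (varsT t) (occ⇒varsL ts eq)

length-subL : ∀ σ ts → length (subL σ ts) ≡ length ts
length-subL σ []       = refl
length-subL σ (t ∷ ts) = cong suc (length-subL σ ts)

subL≡map : ∀ σ ts → subL σ ts ≡ map (subT σ) ts
subL≡map σ []       = refl
subL≡map σ (t ∷ ts) = cong (subT σ t ∷_) (subL≡map σ ts)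

∈-subL⁺ : ∀ σ {t ts} → t ∈ ts → subT σ t ∈ subL σ ts
∈-subL⁺ σ (here refl) = here refl
∈-subL⁺ σ (there m)   = there (∈-subL⁺ σ m)

∈-subL⁻ : ∀ σ {s} ts → s ∈ subL σ ts → ∃[ t ] (t ∈ ts × s ≡ subT σ t)
∈-subL⁻ σ (t ∷ ts) (here refl) = t , here refl , refl
∈-subL⁻ σ (t ∷ ts) (there m) with u , u∈ , eq ← ∈-subL⁻ σ ts m = u , there u∈ , eq

nth-subL⁺ : ∀ σ {t} ts i → nth ts i ≡ just t → nth (subL σ ts) i ≡ just (subT σ t)
nth-subL⁺ σ (t ∷ ts) zero    refl = refl
nth-subL⁺ σ (t ∷ ts) (suc i) eq   = nth-subL⁺ σ ts i eq

nth-subL⁻ : ∀ σ {s} ts i → nth (subL σ ts) i ≡ just s → ∃[ t ] (nth ts i ≡ just t × s ≡ subT σ t)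
nth-subL⁻ σ (t ∷ ts) zero    refl = t , refl , refl
nth-subL⁻ σ (t ∷ ts) (suc i) eq   = nth-subL⁻ σ ts i eq

data Flat : Term → Set where
  fvar : ∀ {x} → Flat (var x)
  fcon : ∀ {c} → Flat (con c)
  fapp : ∀ {f ts} → All Simple ts → Flat (app f ts)

simple-occ : ∀ {x ts} → All Simple ts → occL x ts ≡ true → var x ∈ ts
simple-occ {x} (svar {y} ∷ ss) eq with x ≡ᵇ y in o
... | true  = here (cong var (≡ᵇ-true o))
... | false = there (simple-occ ss eq)
simple-occ (scon ∷ ss) eq = there (simple-occ ss eq)

var-occL : ∀ {x ts} → var x ∈ ts → occL x ts ≡ true
var-occL {x} (here refl) rewrite ≡ᵇ-refl x = refl
var-occL {x} {t ∷ ts} (there m) rewrite var-occL m = ∨-zeroʳ (occ x t)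

depL-simple : ∀ {x ts} → All Simple ts → depL x ts ≡ 0
depL-simple [] = refl
depL-simple {x} (svar {y} ∷ ss) with x ≡ᵇ y
... | true  = depL-simple ss
... | false = depL-simple ss
depL-simple (scon ∷ ss) = depL-simple ss

flat-dep : ∀ {x t} → Flat t → dep x t ≤ 1
flat-dep fvar = z≤n
flat-dep fcon = z≤n
flat-dep {x} (fapp ss) = s≤s (≤-reflexive (depL-simple ss))

flat-occ-height : ∀ σ {x t} → Flat t → occ x t ≡ true → height (σ x) + dep x t ≤ height (subT σ t)
flat-occ-height σ {x} (fvar {y}) eq with refl ← ≡ᵇ-true {x} {y} eq = ≤-reflexive (+-identityʳ _)
flat-occ-height σ {x} (fapp {ts = ts} ss) eq
  rewrite depL-simple {x} ss | +-comm (height (σ x)) 1 = s≤s (height-∈ (∈-subL⁺ σ (simple-occ ss eq)))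

-- The bound is a successor because a complex term with only constants inside has height 1, and the
-- hypothesis says nothing about it.
flat-height : ∀ σ {t m} → Flat t → (∀ {x} → x ∈ varsT t → height (σ x) + dep x t ≤ suc m) →
              height (subT σ t) ≤ suc m
flat-height σ (fvar {x}) h = ≤-trans (≤-reflexive (sym (+-identityʳ _))) (h (here refl))
flat-height σ fcon h = z≤n
flat-height σ {m = m} (fapp {f} {ts} ss) h = s≤s (heightL-≤ below)
  where
  below : ∀ {s} → s ∈ subL σ ts → height s ≤ m
  below s∈ with ∈-subL⁻ σ ts s∈
  ... | t , t∈ , refl with All.lookup ss t∈
  ... | scon = z≤n
  ... | svar {x} = s≤s⁻¹ (≤-trans (≤-reflexive (trans (+-comm 1 _) (cong (λ d → height (σ x) + suc d) (sym (depL-simple ss)))))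
                                   (h (occ⇒varsT (app f ts) (var-occL t∈))))

-- The operator Ω

position : Atom → ℕ → Arg
position a i = arg (pred a) (length (args a)) i

position-sub : ∀ σ a i → position (subA σ a) i ≡ position a i
position-sub σ a i = cong (λ n → arg (pred a) n i) (length-subL σ (args a))

data BodyOcc (r : Rule) (x : ℕ) : Arg → Term → Set where
  occurs : ∀ {b j u} → b ∈ body r → nth (args b) j ≡ just u → occ x u ≡ true →
           BodyOcc r x (position b j) u

bodyOcc : ∀ r {x} → Any (OccA x) (body r) → ∃₂ λ q u → BodyOcc r x q u
bodyOcc r any with b , b∈ , o ← find any with u , u∈ , ou ← find o with j , eq ← ∈-nth u∈ =
  _ , u , occurs b∈ eq ou

bodyArgs⁺ : ∀ {r x q u} → BodyOcc r x q u → (q , u) ∈ bodyArgs r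
bodyArgs⁺ {r} (occurs {b} {j} b∈ eq _) =
  ∈-concatMap⁺ _ (lose b∈ (∈-map⁺ _ (indexed⁺ 0 (args b) j eq)))

bodyArgs⁻ : ∀ {r x q u} → (q , u) ∈ bodyArgs r → occ x u ≡ true → BodyOcc r x q u
bodyArgs⁻ {r} m o with b , b∈ , m′ ← find (∈-concatMap⁻ _ {xs = body r} m)
                  with (j , u) , ju∈ , refl ← ∈-map⁻ _ m′
                  with i , refl , eq ← indexed⁻ 0 (args b) ju∈ = occurs b∈ eq o

minZ-∃ : ∀ {z zs} → z ∈ zs → ∃[ m ] minZ zs ≡ just m
minZ-∃ {zs = z ∷ zs} _ with minZ zs
... | nothing = z , refl
... | just m  = z ℤ.⊓ m , refl

minZ-≤ : ∀ {z m} zs → minZ zs ≡ just m → z ∈ zs → m ℤ.≤ z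
minZ-≤ (z ∷ zs) eq z∈ with minZ zs in e
minZ-≤ (z ∷ zs) refl (here refl) | nothing = ℤₚ.≤-refl
minZ-≤ (z ∷ zs) refl (there z∈) | nothing with () ← trans (sym e) (proj₂ (minZ-∃ z∈))
minZ-≤ (z ∷ zs) refl (here refl) | just m = ℤₚ.i⊓j≤i z m
minZ-≤ (z ∷ zs) refl (there z∈) | just m = ℤₚ.≤-trans (ℤₚ.i⊓j≤j z m) (minZ-≤ zs e z∈)

minZ-∈ : ∀ {m} zs → minZ zs ≡ just m → m ∈ zs
minZ-∈ (z ∷ zs) eq with minZ zs in e
minZ-∈ (z ∷ zs) refl | nothing = here refl
minZ-∈ (z ∷ zs) refl | just m with ℤₚ.⊓-sel z m
... | inj₁ eq rewrite eq = here refl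
... | inj₂ eq rewrite eq = there (minZ-∈ zs e)

foldr-⊔-≥0 : ∀ zs → + 0 ℤ.≤ foldr ℤ._⊔_ (+ 0) zs
foldr-⊔-≥0 []       = ℤₚ.≤-refl
foldr-⊔-≥0 (z ∷ zs) = ℤₚ.i≤j⇒i≤k⊔j z (foldr-⊔-≥0 zs)

foldr-⊔-∈ : ∀ {z zs} → z ∈ zs → z ℤ.≤ foldr ℤ._⊔_ (+ 0) zs
foldr-⊔-∈ {zs = z ∷ zs} (here refl) = ℤₚ.i≤i⊔j z _
foldr-⊔-∈ {zs = z ∷ zs} (there m)   = ℤₚ.i≤j⇒i≤k⊔j z (foldr-⊔-∈ m)

foldr-⊔-lub : ∀ {m} zs → (∀ {z} → z ∈ zs → z ℤ.≤ + m) → foldr ℤ._⊔_ (+ 0) zs ℤ.≤ + m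
foldr-⊔-lub []       h = ℤ.+≤+ z≤n
foldr-⊔-lub (z ∷ zs) h = ℤₚ.⊔-lub (h (here refl)) (foldr-⊔-lub zs (h ∘ there))

weight : Term → Term → ℕ → ℕ → ℤ
weight v u x n = ((+ dep x v) - (+ dep x u)) ℤ.+ (+ n)

shift : ∀ a b c → ((a - b) ℤ.+ c) ℤ.+ b ≡ a ℤ.+ c
shift = solve-∀

unshift : ∀ a b c → ((a - b) ℤ.+ c) ≡ (a ℤ.+ c) - b
unshift = solve-∀

add-sub : ∀ m b → (m ℤ.+ b) - b ≡ m
add-sub = solve-∀

≤-weight⇒ : ∀ {a b c m} → ((+ a) - (+ b)) ℤ.+ (+ c) ℤ.≤ + m → a + c ≤ m + b
≤-weight⇒ {a} {b} {c} {m} le =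
  ℤₚ.drop‿+≤+ (subst (ℤ._≤ + (m + b)) (shift (+ a) (+ b) (+ c)) (ℤₚ.+-monoˡ-≤ (+ b) le))

⇒≤-weight : ∀ {a b c m} → a + c ≤ m + b → ((+ a) - (+ b)) ℤ.+ (+ c) ℤ.≤ + m
⇒≤-weight {a} {b} {c} {m} le =
  subst (ℤ._≤ + m) (sym (unshift (+ a) (+ b) (+ c)))
    (subst ((+ (a + c)) - (+ b) ℤ.≤_) (add-sub (+ m) (+ b)) (ℤₚ.+-monoˡ-≤ (ℤ.- (+ b)) (ℤ.+≤+ le)))

-- Subtraction-free form of D(r,i,X) ≤ m, as witnessed by one of the body occurrences over which D minimizes.
DBound : (Arg → ℕ) → Rule → Term → ℕ → ℕ → Set
DBound φ r v x m = ∃₂ λ q u → BodyOcc r x q u × dep x v + φ q ≤ m + dep x u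

Dval-∃ : ∀ φ r v {x q u} → BodyOcc r x q u → ∃[ D ] Dval φ r v x ≡ just D
Dval-∃ φ r v {x} {q} {u} o@(occurs _ _ ox) = minZ-∃ (∈-concatMap⁺ _ (lose (bodyArgs⁺ o) entry))
  where
  entry : weight v u x (φ q) ∈ (if occ x u then weight v u x (φ q) ∷ [] else [])
  entry rewrite ox = here refl

Dval-≤ : ∀ φ r v {x q u D} → Dval φ r v x ≡ just D → BodyOcc r x q u → D ℤ.≤ weight v u x (φ q)
Dval-≤ φ r v {x} {q} {u} eq o@(occurs _ _ ox) = minZ-≤ _ eq (∈-concatMap⁺ _ (lose (bodyArgs⁺ o) entry))
  where
  entry : weight v u x (φ q) ∈ (if occ x u then weight v u x (φ q) ∷ [] else [])
  entry rewrite ox = here refl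

Dval-attained : ∀ φ r v {x D} → Dval φ r v x ≡ just D → ∃₂ λ q u → BodyOcc r x q u × D ≡ weight v u x (φ q)
Dval-attained φ r v {x} eq with (q , u) , qu∈ , m ← find (∈-concatMap⁻ _ {xs = bodyArgs r} (minZ-∈ _ eq))
  with occ x u in o
... | true with here refl ← m = q , u , bodyArgs⁻ qu∈ o , refl

headTerm⁺ : ∀ r i {v} → nth (args (head r)) i ≡ just v → v ∈ headTerm r (position (head r) i)
headTerm⁺ r i eq rewrite ≡ᵇ-refl (pred (head r)) | ≡ᵇ-refl (length (args (head r))) | eq = here refl

headTerm⁻ : ∀ r {a v} → v ∈ headTerm r a → v ∈ args (head r)
headTerm⁻ r {arg p n i} m with (pred (head r) ≡ᵇ p) ∧ (length (args (head r)) ≡ᵇ n)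
... | true = ∈-maybeList-nth (args (head r)) i m

Dvals : Program → (Arg → ℕ) → Arg → List ℤ
Dvals P φ a =
  concatMap (λ r → concatMap (λ v → concatMap (λ x → maybeList (Dval φ r v x)) (varsT v)) (headTerm r a)) P

+Ω : ∀ P φ a → + Ω P φ a ≡ foldr ℤ._⊔_ (+ 0) (Dvals P φ a)
+Ω P φ a = ℤₚ.0≤i⇒+∣i∣≡i (foldr-⊔-≥0 (Dvals P φ a))

-- The occurrence returned is one attaining the minimum. It may differ from the given one, which
-- serves to show that D is defined.
Ω-lower : ∀ P φ a {r v x q u} → r ∈ P → v ∈ headTerm r a → x ∈ varsT v → BodyOcc r x q u →
          DBound φ r v x (Ω P φ a)
Ω-lower P φ a {r} {v} {x} r∈ v∈ x∈ o
  with D , eq ← Dval-∃ φ r v o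
  with q , u , o′ , D≡ ← Dval-attained φ r v eq =
  q , u , o′ , ≤-weight⇒ {a = dep x v} {dep x u} (subst (ℤ._≤ + Ω P φ a) D≡ (subst (D ℤ.≤_) (sym (+Ω P φ a)) (foldr-⊔-∈ D∈)))
  where
  D∈ : D ∈ Dvals P φ a
  D∈ = ∈-concatMap⁺ _ (lose r∈ (∈-concatMap⁺ _ (lose v∈ (∈-concatMap⁺ _ (lose x∈ (just⇒∈ eq))))))

-- D is a minimum, so one body occurrence that meets the bound suffices for each head variable; the
-- default 0 lies below any natural `m`.
Ω-upper : ∀ P φ a {m} →
          (∀ {r v x q u} → r ∈ P → v ∈ headTerm r a → x ∈ varsT v → BodyOcc r x q u → DBound φ r v x m) →
          Ω P φ a ≤ m
Ω-upper P φ a {m} bound =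
  ℤₚ.drop‿+≤+ (subst (ℤ._≤ + m) (sym (+Ω P φ a)) (foldr-⊔-lub (Dvals P φ a) each))
  where
  value : ∀ {r v x z} → r ∈ P → v ∈ headTerm r a → x ∈ varsT v → ∀ D → Dval φ r v x ≡ D → z ∈ maybeList D → z ℤ.≤ + m
  value {r} {v} r∈ v∈ x∈ (just D) eq (here refl)
    with q₀ , u₀ , o₀ , _ ← Dval-attained φ r v eq
    with q , u , o , le ← bound r∈ v∈ x∈ o₀ = ℤₚ.≤-trans (Dval-≤ φ r v eq o) (⇒≤-weight {b = dep _ u} le)
  each : ∀ {z} → z ∈ Dvals P φ a → z ℤ.≤ + m
  each z∈ with r , r∈ , z∈₁ ← find (∈-concatMap⁻ _ {xs = P} z∈)
          with v , v∈ , z∈₂ ← find (∈-concatMap⁻ _ {xs = headTerm r a} z∈₁)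
          with x , x∈ , z∈₃ ← find (∈-concatMap⁻ _ {xs = varsT v} z∈₂) = value r∈ v∈ x∈ _ refl z∈₃

Ω-mono : ∀ P {φ φ′} → (∀ a → φ a ≤ φ′ a) → ∀ a → Ω P φ a ≤ Ω P φ′ a
Ω-mono P {φ} {φ′} le a = Ω-upper P φ a λ r∈ v∈ x∈ o →
  let q , u , o′ , b = Ω-lower P φ′ a r∈ v∈ x∈ o in q , u , o′ , ≤-trans (+-monoʳ-≤ _ (le q)) b

Ωiter-suc : ∀ P k a → Ωiter P k a ≤ Ωiter P (suc k) a
Ωiter-suc P zero    a = z≤n
Ωiter-suc P (suc k) a = Ω-mono P (Ωiter-suc P k) a

Ωiter-mono : ∀ P {k k′} → k ≤ k′ → ∀ a → Ωiter P k a ≤ Ωiter P k′ a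
Ωiter-mono P {k} k≤k′ a = go (≤⇒≤′ k≤k′)
  where
  go : ∀ {k′} → k ≤′ k′ → Ωiter P k a ≤ Ωiter P k′ a
  go ≤′-refl = ≤-refl
  go (≤′-step {n} le) = ≤-trans (go le) (Ωiter-suc P n a)

-- Limits of restricted arguments

argsOf : Program → List Arg
argsOf P = concatMap (λ r → concatMap (λ a → map (position a) (upTo (length (args a)))) (head r ∷ body r)) P

position-∈ : ∀ {P r a t} i → r ∈ P → a ∈ (head r ∷ body r) → nth (args a) i ≡ just t → position a i ∈ argsOf P
position-∈ {a = a} i r∈ a∈ eq =
  ∈-concatMap⁺ _ (lose r∈ (∈-concatMap⁺ _ (lose a∈ (∈-map⁺ _ (∈-upTo⁺ (nth-< (args a) i eq))))))

argTerm-flat : ∀ {P r a t} → DepthAtMostOne P → r ∈ P → a ∈ (head r ∷ body r) → t ∈ args a → Flat t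
argTerm-flat {t = var x}    d₁ r∈ a∈ t∈ = fvar
argTerm-flat {t = con c}    d₁ r∈ a∈ t∈ = fcon
argTerm-flat {t = app f ts} d₁ r∈ a∈ t∈ = fapp (d₁ (_ , r∈ , _ , a∈ , _ , t∈ , ⊑-refl))

-- Since the iterates increase, this one-sided bound already makes `Ωiter P K a` the limit at `a`.
StableFrom : Program → ℕ → Arg → Set
StableFrom P K a = ∀ k → Ωiter P k a ≤ Ωiter P K a

StableFrom-up : ∀ P {K K′ a} → K ≤ K′ → StableFrom P K a → StableFrom P K′ a
StableFrom-up P K≤K′ st k = ≤-trans (st k) (Ωiter-mono P K≤K′ _)

AR⇒StableFrom : ∀ P {a} → AR P a → ∃[ K ] StableFrom P K a
AR⇒StableFrom P {a} (K , const) = K , λ k →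
  [ (λ k≤K → Ωiter-mono P k≤K a) , (λ K≤k → ≤-reflexive (const k K≤k)) ]′ (≤-total k K)

-- If no limit equals v, then lowering by one every limit above v again gives a
-- pre-fixpoint of Ω, because a step of Ω raises a value by at most one; hence all
-- iterates stay below it.
stays-below-limit : ∀ P → DepthAtMostOne P → ∀ K B v →
  (∀ {b} → b ∈ argsOf P → (StableFrom P K b × Ωiter P K b ≤ B) ⊎ suc B < Ωiter P K b) →
  (∀ {b} → b ∈ argsOf P → Ωiter P K b ≢ v) →
  ∀ k {b} → StableFrom P K b → Ωiter P K b ≤ B → v < Ωiter P K b → Ωiter P k b < Ωiter P K b
stays-below-limit P d₁ K B v settled gap zero st ≤B v< = ≤-<-trans z≤n v<
stays-below-limit P d₁ K B v settled gap (suc k) {b} st ≤B v< with Ωiter P K b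
... | suc m = s≤s (Ω-upper P (Ωiter P k) b step)
  where
  step : ∀ {r t x q u} → r ∈ P → t ∈ headTerm r b → x ∈ varsT t → BodyOcc r x q u → DBound (Ωiter P k) r t x m
  -- The occurrence attaining D at stage `K` is reused at stage `k`, where any witness of the bound
  -- will do.
  step {r} {t} {x} r∈ t∈ x∈ o with Ω-lower P (Ωiter P K) b r∈ t∈ x∈ o
  ... | q , u , o′@(occurs {b′} {j} b∈ eq _) , le = q , u , o′ , s≤s⁻¹ bound
    where
    q∈ : q ∈ argsOf P
    q∈ = position-∈ j r∈ (there b∈) eq
    dep-t : dep x t ≤ 1
    dep-t = flat-dep (argTerm-flat d₁ r∈ (here refl) (headTerm⁻ r t∈))
    dep-u : dep x u ≤ 1
    dep-u = flat-dep (argTerm-flat d₁ r∈ (there b∈) (nth-∈ (args b′) j eq))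
    at-limit : dep x t + Ωiter P K q ≤ suc m + dep x u
    at-limit = ≤-trans le (+-monoˡ-≤ _ (st (suc K)))
    bound : dep x t + Ωiter P k q < suc m + dep x u
    bound with settled q∈
    -- By `at-limit`, the value at `q` is at most `B + 1`, so `q` is not among the arguments beyond
    -- `suc B`.
    ... | inj₂ big = ⊥-elim (<⇒≱ big (≤-trans (m≤n+m _ (dep x t)) (≤-trans at-limit
                       (≤-trans (+-mono-≤ ≤B dep-u) (≤-reflexive (+-comm B 1))))))
    ... | inj₁ (st-q , q≤B) with <-cmp v (Ωiter P K q)
    ... | tri< v<q _ _ = <-≤-trans (+-monoʳ-< (dep x t) (stays-below-limit P d₁ K B v settled gap k st-q q≤B v<q)) at-limit
    ... | tri≈ _ v≡q _ = ⊥-elim (gap q∈ (sym v≡q))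
    -- A limit below `v` leaves room for one added level, because `v ≤ m`.
    ... | tri> _ _ q<v = s≤s (≤-trans (+-mono-≤ dep-t (st-q k)) (≤-trans (≤-trans q<v (s≤s⁻¹ v<)) (m≤m+n m _)))

-- Limits up to `B` and values above `suc B` differ by at least two, more than one step of Ω can
-- bridge.
Separated : Program → ℕ → ℕ → Arg → Set
Separated P B K b =
  (StableFrom P K b × Ωiter P K b ≤ B) ⊎ (suc B < Ωiter P K b × (∀ K′ → ¬ StableFrom P K′ b))

-- Two rounds: first a stage is reached by which every stabilising argument has its limit, and `B`
-- is the largest value there. Then the stage is raised until all other arguments exceed `suc B`,
-- which moves no limit.
settle : ∀ P → ¬ ¬ (∃₂ λ K B → ∀ {b} → b ∈ argsOf P → Separated P B K b)
settle P k = eventually up₁ (argsOf P) (λ _ → decide) λ { (K , dich) →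
  let B = max 0 (map (Ωiter P K) (argsOf P)) in
  eventually (up₂ B) (argsOf P) (λ b∈ → separate K B (dich b∈) (All.lookup (xs≤max 0 _) (∈-map⁺ (Ωiter P K) b∈)))
    λ { (K′ , h) → k (K′ , B , h) } }
  where
  Dichotomy : ℕ → Arg → Set
  Dichotomy K b = StableFrom P K b ⊎ (∀ K′ → ¬ StableFrom P K′ b)
  up₁ : ∀ {K K′ b} → K ≤ K′ → Dichotomy K b → Dichotomy K′ b
  up₁ K≤ (inj₁ st) = inj₁ (StableFrom-up P K≤ st)
  up₁ K≤ (inj₂ unb) = inj₂ unb
  decide : ∀ {b} → ¬ ¬ (∃[ K ] Dichotomy K b)
  decide {b} k = ¬¬-excluded-middle {A = ∃[ K ] StableFrom P K b} λ where
    (yes (K , st)) → k (K , inj₁ st)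
    (no none) → k (0 , inj₂ λ K′ st → none (K′ , st))
  up₂ : ∀ B {K K′ b} → K ≤ K′ → Separated P B K b → Separated P B K′ b
  up₂ B {K′ = K′} K≤ (inj₁ (st , ≤B)) = inj₁ (StableFrom-up P K≤ st , ≤-trans (st K′) ≤B)
  up₂ B K≤ (inj₂ (big , unb)) = inj₂ (<-≤-trans big (Ωiter-mono P K≤ _) , unb)
  separate : ∀ K B {b} → Dichotomy K b → Ωiter P K b ≤ B → ¬ ¬ (∃[ K′ ] Separated P B K′ b)
  separate K B (inj₁ st) ≤B k = k (K , inj₁ (st , ≤B))
  separate K B {b} (inj₂ unb) ≤B k =
    -- An argument never exceeding `suc B` would attain a maximum and so be stable.
    bounded⇒attains-max (λ k → Ωiter P k b) (suc B) (λ K′ → ≮⇒≥ λ big → k (K′ , inj₂ (big , unb)))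
      λ { (K′ , st) → unb K′ st }

-- The goal is a negation, so `settle` applies. A limit of at least `length (argsOf P)` leaves some
-- level `v` below it that no argument takes, and `stays-below-limit` at stage `K` then puts the
-- limit below itself.
AR-bound : ∀ P → DepthAtMostOne P → ∀ {a} k → a ∈ argsOf P → length (argsOf P) ≤ Ωiter P k a → ¬ AR P a
AR-bound P d₁ {a} k a∈ n≤ ar with K₀ , st₀ ← AR⇒StableFrom P ar = settle P contra
  where
  contra : ¬ (∃₂ λ K B → ∀ {b} → b ∈ argsOf P → Separated P B K b)
  contra (K , B , sep) with sep a∈
  ... | inj₂ (_ , unb) = unb K₀ st₀
  ... | inj₁ (st , ≤B) with v , v< , gap ← missing-level (Ωiter P K) (argsOf P) a∈ (≤-trans n≤ (st k)) =
    <-irrefl refl (stays-below-limit P d₁ K B v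
      (λ b∈ → [ inj₁ , (λ { (big , _) → inj₂ big }) ]′ (sep b∈)) gap K st ≤B v<)

-- Heights of derivable terms

mutual
  -- The premises are passed along with their induction hypotheses, so that the derivation of the
  -- head can be rebuilt.
  M-ind : ∀ {P} {Q : Atom → Set} →
          (∀ {r} σ → r ∈ P → GroundSubst σ → All (M P) (map (subA σ) (body r)) →
             All Q (map (subA σ) (body r)) → Q (subA σ (head r))) →
          ∀ {a} → M P a → Q a
  M-ind step (derive σ r∈ gσ ms) = step σ r∈ gσ ms (M-indAll step ms)

  M-indAll : ∀ {P} {Q : Atom → Set} →
             (∀ {r} σ → r ∈ P → GroundSubst σ → All (M P) (map (subA σ) (body r)) →
                All Q (map (subA σ) (body r)) → Q (subA σ (head r))) →
             ∀ {as} → All (M P) as → All Q as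
  M-indAll step []       = []
  M-indAll step (m ∷ ms) = M-ind step m ∷ M-indAll step ms

head-occ : ∀ {P r x v} → RangeRestricted P → r ∈ P → v ∈ args (head r) → occ x v ≡ true →
           ∃₂ λ q u → BodyOcc r x q u
head-occ {r = r} rr r∈ v∈ ox = bodyOcc r (rr r∈ _ (lose v∈ ox))

-- The added 1 allows for head terms without variables: Ω ignores them, but their height may be 1.
HeightsWithin : Program → ℕ → Atom → Set
HeightsWithin P k a = ∀ i {t} → nth (args a) i ≡ just t → height t ≤ suc (Ωiter P k (position a i))

HeightsWithin-up : ∀ P a {k k′} → k ≤ k′ → HeightsWithin P k a → HeightsWithin P k′ a
HeightsWithin-up P a k≤ h i eq = ≤-trans (h i eq) (s≤s (Ωiter-mono P k≤ _))

common-stage : ∀ P {as} → All (λ a → ∃[ k ] HeightsWithin P k a) as → ∃[ k ] All (HeightsWithin P k) as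
common-stage P [] = 0 , []
common-stage P {a ∷ _} ((k , h) ∷ hs) with k′ , hs′ ← common-stage P hs =
  k ⊔ k′ , HeightsWithin-up P a (m≤m⊔n k k′) h ∷ All.map (λ {b} → HeightsWithin-up P b (m≤n⊔m k k′)) hs′

-- One rule application is matched by one application of Ω. The occurrence attaining D bounds the
-- height of `σ x` through the body term containing it.
M⇒HeightsWithin : ∀ P → RangeRestricted P → DepthAtMostOne P → ∀ {a} → M P a → ∃[ k ] HeightsWithin P k a
M⇒HeightsWithin P rr d₁ = M-ind step
  where
  step : ∀ {r} σ → r ∈ P → GroundSubst σ → All (M P) (map (subA σ) (body r)) →
         All (λ a → ∃[ k ] HeightsWithin P k a) (map (subA σ) (body r)) → ∃[ k ] HeightsWithin P k (subA σ (head r))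
  step {r} σ r∈ _ _ hs with k , hs′ ← common-stage P hs = suc k , within
    where
    within : HeightsWithin P (suc k) (subA σ (head r))
    within i eq with v , eqv , refl ← nth-subL⁻ σ (args (head r)) i eq =
      subst (λ q → height (subT σ v) ≤ suc (Ωiter P (suc k) q)) (sym (position-sub σ (head r) i))
        (flat-height σ (argTerm-flat d₁ r∈ (here refl) v∈) below)
      where
      v∈ : v ∈ args (head r)
      v∈ = nth-∈ _ i eqv
      below : ∀ {x} → x ∈ varsT v → height (σ x) + dep x v ≤ suc (Ωiter P (suc k) (position (head r) i))
      below {x} x∈
        with _ , _ , o ← head-occ {r = r} rr r∈ v∈ (varsT⇒occ v x∈)
        with _ , u , occurs {b} {j} b∈ equ ox , le ← Ω-lower P (Ωiter P k) _ r∈ (headTerm⁺ r i eqv) x∈ o =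
        +-cancelʳ-≤ (dep x u) _ _ (begin
          height (σ x) + dep x v + dep x u   ≡⟨ +-assoc (height (σ x)) _ _ ⟩
          height (σ x) + (dep x v + dep x u) ≡⟨ cong (λ n → height (σ x) + n) (+-comm (dep x v) _) ⟩
          height (σ x) + (dep x u + dep x v) ≡⟨ +-assoc (height (σ x)) _ _ ⟨
          height (σ x) + dep x u + dep x v   ≤⟨ +-monoˡ-≤ _ (flat-occ-height σ (argTerm-flat d₁ r∈ (there b∈) (nth-∈ _ j equ)) ox) ⟩
          height (subT σ u) + dep x v        ≤⟨ +-monoˡ-≤ _ (All.lookup hs′ (∈-map⁺ (subA σ) b∈) j (nth-subL⁺ σ (args b) j equ)) ⟩
          suc (Ωiter P k (position (subA σ b) j)) + dep x v ≡⟨ cong (λ q → suc (Ωiter P k q) + dep x v) (position-sub σ b j) ⟩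
          suc (Ωiter P k (position b j)) + dep x v ≡⟨ +-comm _ (dep x v) ⟩
          dep x v + suc (Ωiter P k (position b j)) ≡⟨ +-suc (dep x v) _ ⟩
          suc (dep x v + Ωiter P k (position b j)) ≤⟨ s≤s le ⟩
          suc (Ωiter P (suc k) (position (head r) i)) + dep x u ∎)
        where open ≤-Reasoning

-- Walks spelling words of the grammar

S₁-++ : ∀ {P x y} → S₁ P x → S₁ P y → S₁ P (x ++ y)
S₁-++ s₁ε t = t
S₁-++ {P} {y = y} (s₁f {f} {u} {v} fp s s′) t =
  subst (S₁ P) (cong (fw f ∷_) (sym (++-assoc u (bw f ∷ v) y))) (s₁f fp s (S₁-++ s′ t))

S₂-++ : ∀ {P x y} → S₂ P x → S₂ P y → S₂ P (x ++ y)
S₂-++ s₂ε t = t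
S₂-++ {P} {y = y} (s₂S {u} {v} s s′) t = subst (S₂ P) (sym (++-assoc u v y)) (s₂S s (S₂-++ s′ t))
S₂-++ (s₂f fp s) t = s₂f fp (S₂-++ s t)

S₁⇒S₂ : ∀ {P x} → S₁ P x → S₂ P x
S₁⇒S₂ {P} {x} s = subst (S₂ P) (++-identityʳ x) (s₂S s s₂ε)

-- In contrast to a `Path`, a walk may be empty; `walk⇒path` recovers a path once a first edge is
-- supplied.
data Walk (E : Arg → Arg → Label → Set) : Arg → Arg → List Letter → Set where
  []  : ∀ {a} → Walk E a a []
  _∷_ : ∀ {a b c α w} → E a b α → Walk E b c w → Walk E a c (lab α ++ w)

walk-++ : ∀ {E a b c v w} → Walk E a b v → Walk E b c w → Walk E a c (v ++ w)
walk-++ [] q = q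
walk-++ {E} {w = w} (_∷_ {α = α} {w = u} e p) q =
  subst (Walk E _ _) (sym (++-assoc (lab α) u w)) (e ∷ walk-++ p q)

walk⇒path : ∀ {E a b c α w} → E a b α → Walk E b c w → Path E a c (lab α ++ w)
walk⇒path {E} {a} {b} {α = α} e [] = subst (Path E a b) (sym (++-identityʳ (lab α))) (one e)
walk⇒path e (e′ ∷ p) = more e (walk⇒path e′ p)

walk⇒Star : ∀ {E a b w} → Walk E a b w → Star (Step E) a b
walk⇒Star [] = ε
walk⇒Star (e ∷ p) = (_ , e) ◅ walk⇒Star p

source-onPath : ∀ {E a b w} (p : Path E a b w) → OnPath E a p
source-onPath (one e) = src1 e
source-onPath (more e p) = srcM e p

Balanced : Program → Arg → Arg → Set
Balanced P a b = ∃[ w ] (Walk (ΔEdge P) a b w × S₁ P w)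

balanced-++ : ∀ {P a b c} → Balanced P a b → Balanced P b c → Balanced P a c
balanced-++ (_ , p , s) (_ , q , t) = _ , walk-++ p q , S₁-++ s t

-- The word of a rise has the form f S₂, hence lies in `LΓ` with an empty `S₁` prefix.
data Rise (P : Program) (a b : Arg) : Set where
  rise : ∀ {f c w} → FP P f → ΔEdge P a c (just (fw f)) → Walk (ΔEdge P) c b w → S₂ P w → Rise P a b

rise-trans : ∀ {P a b c} → Rise P a b → Rise P b c → Rise P a c
rise-trans (rise fp e p s) (rise fp′ e′ q t) = rise fp e (walk-++ p (e′ ∷ q)) (S₂-++ s (s₂f fp′ t))

rise-cycle : ∀ {P a b} → Rise P a a → Rise P a b → DependsOnBadCycle P b
rise-cycle (rise fp e p s) (rise _ e′ q _) =
  _ , _ , walk⇒path e p , sS s₁ε fp s , _ , source-onPath (walk⇒path e p) , ((_ , e′) ◅ walk⇒Star q)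

edge-FP : ∀ {P a b f} → Edge P a b (just (fw f)) → FP P f
edge-FP (edge {r} {i = i} r∈ _ _ eqv (fwd {ts = ts} _)) =
  ts , refl , r , r∈ , head r , here refl , _ , nth-∈ _ i eqv , ⊑-refl

edge-source : ∀ {P a b α} → Edge P a b α → a ∈ argsOf P
edge-source (edge {j = j} r∈ b∈ equ _ _) = position-∈ j r∈ (there b∈) equ

-- Stack histories

-- A branch may stop at any subterm. `root` supplies the symbol of a term without arguments, which
-- `sub` cannot reach. Arities are recorded to match the edge labels.
data Branch : List FSym → Term → Set where
  tip  : ∀ {t} → Branch [] t
  root : ∀ {f ts} → Branch ((f , length ts) ∷ []) (app f ts)
  sub  : ∀ {f ts t s} → t ∈ ts → Branch s t → Branch ((f , length ts) ∷ s) (app f ts)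

branch-length : ∀ {s t} → Branch s t → length s ≤ height t
branch-length tip = z≤n
branch-length root = s≤s z≤n
branch-length (sub t∈ br) = s≤s (≤-trans (branch-length br) (height-∈ t∈))

mutual
  deepest-branch : ∀ t → ∃[ s ] (Branch s t × length s ≡ height t)
  deepest-branch (var x) = [] , tip , refl
  deepest-branch (con c) = [] , tip , refl
  deepest-branch (app f []) = _ , root , refl
  deepest-branch (app f (t ∷ ts)) with u , s , u∈ , br , eq ← deepest-branchL t ts =
    _ , sub u∈ br , cong suc eq

  deepest-branchL : ∀ t ts → ∃₂ λ u s → u ∈ (t ∷ ts) × Branch s u × length s ≡ heightL (t ∷ ts)
  deepest-branchL t [] with s , br , eq ← deepest-branch t =
    t , s , here refl , br , trans eq (sym (⊔-identityʳ _))
  deepest-branchL t (t′ ∷ ts) with ≤-total (height t) (heightL (t′ ∷ ts))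
  ... | inj₁ le with u , s , u∈ , br , eq ← deepest-branchL t′ ts =
    u , s , there u∈ , br , trans eq (sym (m≤n⇒m⊔n≡n le))
  ... | inj₂ ge with s , br , eq ← deepest-branch t = t , s , here refl , br , trans eq (sym (m≥n⇒m⊔n≡m ge))

-- A branch of a value is a stack: following the derivation forward, an edge labelled
-- f pushes f and one labelled f̄ pops it. The history records, for every symbol still
-- on the stack above height N, the edge that pushed it and the balanced walk since.
data History (P : Program) (N : ℕ) : Arg → List FSym → Set where
  short  : ∀ {a s} → length s ≤ N → History P N a s
  pushed : ∀ {a b c f s} → History P N a s → ΔEdge P a b (just (fw f)) → Balanced P b c →
           History P N c (f ∷ s)

history-balanced : ∀ {P N a b s} → History P N a s → Balanced P a b → History P N b s
history-balanced (short le) _ = short le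
history-balanced (pushed h e β) β′ = pushed h e (balanced-++ β β′)

history-eps : ∀ {P N a b s} → History P N a s → ΔEdge P a b nothing → History P N b s
history-eps h e = history-balanced h (_ , e ∷ [] , s₁ε)

history-pop : ∀ {P N a b f s} → History P N a (f ∷ s) → ΔEdge P a b (just (bw f)) → History P N b s
history-pop (short le) e = short (≤-trans (n≤1+n _) le)
history-pop (pushed h e (_ , p , s)) e′ =
  history-balanced h (_ , e ∷ walk-++ p (e′ ∷ []) , s₁f (edge-FP (proj₁ e)) s s₁ε)

-- `cs` lists the sources of the recorded pushes, latest first. An earlier push is still on the
-- stack at a later one, so the walk between them is a rise from old to new; hence the `flip`.
push-nodes : ∀ {P N b s} → History P N b s →
             ∃[ cs ] (length s ≤ N + length cs × All (_∈ argsOf P) cs × AllPairs (flip (Rise P)) (b ∷ cs))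
push-nodes {N = N} (short le) = [] , ≤-trans le (≤-reflexive (sym (+-identityʳ N))) , [] , [] ∷ []
push-nodes {N = N} (pushed {a} h e (_ , p , s)) with cs , le , cs∈ , above ∷ pairs ← push-nodes h =
  a ∷ cs , ≤-trans (s≤s le) (≤-reflexive (sym (+-suc N _))) , edge-source (proj₁ e) ∷ cs∈ ,
  (up ∷ All.map (λ r → rise-trans r up) above) ∷ above ∷ pairs
  where
  up = rise (edge-FP (proj₁ e)) e p (S₁⇒S₂ s)

allPairs-lookup : ∀ {A : Set} {R : A → A → Set} {xs} → AllPairs R xs → ∀ {i j} → i Fin.< j →
                  R (lookup xs i) (lookup xs j)
allPairs-lookup (rs ∷ _) {Fin.zero} {Fin.suc j} _ = All.lookup rs (∈-lookup j)
allPairs-lookup (_ ∷ ps) {Fin.suc i} {Fin.suc j} (s≤s lt) = allPairs-lookup ps lt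

-- There are more recorded pushes than arguments, so two share a source. The rise from the older to
-- the newer closes the cycle, and the rise from the newer to `b` gives the dependence.
long-history⇒bad-cycle : ∀ {P N b s} → History P N b s → N + length (argsOf P) < length s → DependsOnBadCycle P b
long-history⇒bad-cycle {P} {N} {b} h lt with cs , le , cs∈ , above ∷ pairs ← push-nodes h
  with i , j , i<j , eq ← pigeonhole-∈ (argsOf P) (lookup cs) (λ i → All.lookup cs∈ (∈-lookup i))
                             (+-cancelˡ-< N _ _ (<-≤-trans lt le)) =
  rise-cycle (subst (λ c → Rise P c (lookup cs i)) (sym eq) (allPairs-lookup pairs i<j)) (All.lookup above (∈-lookup i))

-- Terms taller than this occur only at arguments outside AR(P). Being a successor, it also makes
-- every stack of one symbol short.
threshold : Program → ℕ
threshold P = suc (length (argsOf P))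

tall⇒¬AR : ∀ P → RangeRestricted P → DepthAtMostOne P → ∀ {a t} i → M P a → nth (args a) i ≡ just t →
           position a i ∈ argsOf P → threshold P < height t → ¬ AR P (position a i)
tall⇒¬AR P rr d₁ i m eq a∈ tall with k , h ← M⇒HeightsWithin P rr d₁ m =
  AR-bound P d₁ k a∈ (≤-trans (n≤1+n _) (s≤s⁻¹ (≤-trans tall (h i eq))))

-- A long stack in the head is traced to a body term sharing the variable below it; the edge copies,
-- pops or pushes according to which of the two terms is complex.
M⇒History : ∀ P → RangeRestricted P → AtMostOneComplex P → DepthAtMostOne P → ∀ {a} → M P a →
            ∀ i {t s} → nth (args a) i ≡ just t → Branch s t → History P (threshold P) (position a i) s
M⇒History P rr one-complex d₁ = M-ind step
  where
  Traced : Atom → Set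
  Traced a = ∀ i {t s} → nth (args a) i ≡ just t → Branch s t → History P (threshold P) (position a i) s
  step : ∀ {r} σ → r ∈ P → GroundSubst σ → All (M P) (map (subA σ) (body r)) →
         All Traced (map (subA σ) (body r)) → Traced (subA σ (head r))
  step {r} σ r∈ gσ ms hs i {s = s} eq br with length s ≤? threshold P
  ... | yes le = short le
  ... | no long with v , eqv , refl ← nth-subL⁻ σ (args (head r)) i eq =
    subst (λ q → History P (threshold P) q s) (sym (position-sub σ (head r) i))
      (trace (argTerm-flat d₁ r∈ (here refl) v∈) eqv br (≰⇒> long))
    where
    v∈ : v ∈ args (head r)
    v∈ = nth-∈ _ i eqv
    -- A long stack sits in a tall term, so no edge into this node is removed from Δ(P).
    ¬ar : ¬ AR P (position (head r) i)
    ¬ar = subst (λ q → ¬ AR P q) (position-sub σ (head r) i)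
      (tall⇒¬AR P rr d₁ i (derive σ r∈ gσ ms) eq
        (subst (_∈ argsOf P) (sym (position-sub σ (head r) i)) (position-∈ i r∈ (here refl) eqv))
        (<-≤-trans (≰⇒> long) (branch-length br)))
    body-history : ∀ {b j u s′} → b ∈ body r → nth (args b) j ≡ just u → Branch s′ (subT σ u) →
                   History P (threshold P) (position b j) s′
    body-history {b} {j} {s′ = s′} b∈ equ br =
      subst (λ q → History P (threshold P) q s′) (position-sub σ b j)
        (All.lookup hs (∈-map⁺ (subA σ) b∈) j (nth-subL⁺ σ (args b) j equ) br)
    trace : ∀ {v s} → Flat v → nth (args (head r)) i ≡ just v → Branch s (subT σ v) → threshold P < length s →
            History P (threshold P) (position (head r) i) s
    trace (fvar {x}) eqv br lt
      with _ , u , occurs {b} {j} b∈ equ ox ← head-occ {r = r} rr r∈ (nth-∈ _ i eqv) (≡ᵇ-refl x)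
      with argTerm-flat d₁ r∈ (there b∈) (nth-∈ (args b) j equ)
    ... | fvar {y} with refl ← ≡ᵇ-true {x} {y} ox =
      history-eps (body-history b∈ equ br) (edge r∈ b∈ equ eqv eps , ¬ar)
    -- The body term has `f` on top of the branch, and the edge pops it.
    ... | fapp {f} {ts} ss =
      history-pop (body-history b∈ equ (subst (λ n → Branch ((f , n) ∷ _) (app f (subL σ ts))) (length-subL σ ts) (sub (∈-subL⁺ σ x∈) br)))
                  (edge r∈ b∈ equ eqv (bwd x∈) , ¬ar)
      where
      x∈ : var x ∈ ts
      x∈ = simple-occ ss ox
    trace fcon eqv tip ()
    trace (fapp _) eqv tip ()
    trace (fapp _) eqv root (s≤s ())
    trace (fapp {f} {ts} ss) eqv (sub t∈ br) lt with _ , t′∈ , refl ← ∈-subL⁻ σ ts t∈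
      with All.lookup ss t′∈ | br
    ... | scon | tip with s≤s () ← lt
    ... | svar {x} | br
      with _ , u , occurs {b} {j} b∈ equ ox ← head-occ {r = r} rr r∈ (nth-∈ _ i eqv) (var-occL t′∈)
      with argTerm-flat d₁ r∈ (there b∈) (nth-∈ (args b) j equ)
    -- The head term is complex, so the body term must be a bare variable and the edge is a push.
    ... | fapp _ = ⊥-elim (one-complex r∈ (nth-∈ _ i eqv) b∈ (nth-∈ (args b) j equ) x (var-occL t′∈) ox (capp , capp))
    ... | fvar {y} with refl ← ≡ᵇ-true {x} {y} ox =
      pushed (body-history b∈ equ br)
        (subst (λ n → ΔEdge P _ _ (just (fw (f , n)))) (sym (length-subL σ ts)) (edge r∈ b∈ equ eqv (fwd t′∈) , ¬ar))
        ([] , [] , s₁ε)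

heightBound : Program → ℕ
heightBound P = threshold P + length (argsOf P)

no-bad-cycle⇒height : ∀ P → RangeRestricted P → AtMostOneComplex P → DepthAtMostOne P → ∀ {a t} i → M P a →
                      nth (args a) i ≡ just t → ¬ DependsOnBadCycle P (position a i) → height t ≤ heightBound P
no-bad-cycle⇒height P rr oc d₁ {t = t} i m eq ok with height t ≤? heightBound P
... | yes le = le
... | no tall with s , br , len ← deepest-branch t =
  ⊥-elim (ok (long-history⇒bad-cycle (M⇒History P rr oc d₁ m i eq br) (subst (heightBound P <_) (sym len) (≰⇒> tall))))

-- Finitely many terms of bounded height

mutual
  subterms : Term → List Term
  subterms (var x)    = var x ∷ []
  subterms (con c)    = con c ∷ []
  subterms (app f ts) = app f ts ∷ subtermsL ts

  subtermsL : List Term → List Term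
  subtermsL []       = []
  subtermsL (t ∷ ts) = subterms t ++ subtermsL ts

self-∈-subterms : ∀ t → t ∈ subterms t
self-∈-subterms (var x)    = here refl
self-∈-subterms (con c)    = here refl
self-∈-subterms (app f ts) = here refl

∈-subtermsL : ∀ {s t ts} → t ∈ ts → s ∈ subterms t → s ∈ subtermsL ts
∈-subtermsL (here refl) m = ∈-++⁺ˡ m
∈-subtermsL {ts = u ∷ _} (there t∈) m = ∈-++⁺ʳ (subterms u) (∈-subtermsL t∈ m)

⊑⇒∈-subterms : ∀ {s t} → s ⊑ t → s ∈ subterms t
⊑⇒∈-subterms {t = t} ⊑-refl = self-∈-subterms t
⊑⇒∈-subterms (⊑-sub t∈ s⊑) = there (∈-subtermsL t∈ (⊑⇒∈-subterms s⊑))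

termsOf : Program → List Term
termsOf P = concatMap (λ r → concatMap (λ a → concatMap subterms (args a)) (head r ∷ body r)) P

TermOf⇒∈ : ∀ {P s} → TermOf P s → s ∈ termsOf P
TermOf⇒∈ (_ , r∈ , _ , a∈ , _ , t∈ , s⊑) =
  ∈-concatMap⁺ _ (lose r∈ (∈-concatMap⁺ _ (lose a∈ (∈-concatMap⁺ _ (lose t∈ (⊑⇒∈-subterms s⊑))))))

choices : ∀ {A : Set} → List (List A) → List (List A)
choices []         = [] ∷ []
choices (xs ∷ xss) = cartesianProductWith _∷_ xs (choices xss)

∈-choices-map : ∀ {A B : Set} (f : A → B) (F : A → List B) as → (∀ {a} → a ∈ as → f a ∈ F a) →
                map f as ∈ choices (map F as)
∈-choices-map f F []       h = here refl
∈-choices-map f F (a ∷ as) h = ∈-cartesianProductWith⁺ _∷_ (h (here refl)) (∈-choices-map f F as (h ∘ there))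

∈-choices-replicate : ∀ {A : Set} {S : List A} {xs} → All (_∈ S) xs → xs ∈ choices (replicate (length xs) S)
∈-choices-replicate []       = here refl
∈-choices-replicate (x ∷ xs) = ∈-cartesianProductWith⁺ _∷_ x (∈-choices-replicate xs)

-- Ground substitutions may use any symbols, so groundness and bounded height alone leave infinitely
-- many terms. Here all symbols, with their arities, come from `P`.
data Built (P : Program) : Term → Set where
  bcon : ∀ {c} → TermOf P (con c) → Built P (con c)
  bapp : ∀ {f us ts} → TermOf P (app f us) → length us ≡ length ts → All (Built P) ts → Built P (app f ts)

built-occ : ∀ {P} σ {x t} → Flat t → Built P (subT σ t) → occ x t ≡ true → Built P (σ x)
built-occ σ {x} (fvar {y}) bt ox with refl ← ≡ᵇ-true {x} {y} ox = bt
built-occ σ (fapp ss) (bapp _ _ bts) ox = All.lookup bts (∈-subL⁺ σ (simple-occ ss ox))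

built-sub : ∀ {P} σ {t} → Flat t → (∀ {s} → s ⊑ t → TermOf P s) → (∀ x → occ x t ≡ true → Built P (σ x)) →
            Built P (subT σ t)
built-sub σ (fvar {x}) tm bσ = bσ x (≡ᵇ-refl x)
built-sub σ fcon tm bσ = bcon (tm ⊑-refl)
built-sub {P} σ (fapp {f} {ts} ss) tm bσ = bapp (tm ⊑-refl) (sym (length-subL σ ts)) (All.tabulate arg-built)
  where
  arg-built : ∀ {s} → s ∈ subL σ ts → Built P s
  arg-built s∈ with t , t∈ , refl ← ∈-subL⁻ σ ts s∈ with All.lookup ss t∈
  ... | scon = bcon (tm (⊑-sub t∈ ⊑-refl))
  ... | svar {x} = bσ x (var-occL t∈)

-- By range restriction the value of each head variable is part of a body term and inherits its
-- symbols.
M⇒Built : ∀ P → RangeRestricted P → DepthAtMostOne P → ∀ {a} → M P a → All (Built P) (args a)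
M⇒Built P rr d₁ = M-ind step
  where
  step : ∀ {r} σ → r ∈ P → GroundSubst σ → All (M P) (map (subA σ) (body r)) →
         All (λ a → All (Built P) (args a)) (map (subA σ) (body r)) → All (Built P) (args (subA σ (head r)))
  step {r} σ r∈ _ _ hs = All.tabulate λ t∈ → go (∈-subL⁻ σ (args (head r)) t∈)
    where
    go : ∀ {t} → ∃[ v ] (v ∈ args (head r) × t ≡ subT σ v) → Built P t
    go (v , v∈ , refl) = built-sub σ (argTerm-flat d₁ r∈ (here refl) v∈)
      (λ s⊑ → r , r∈ , head r , here refl , v , v∈ , s⊑) λ x ox → from-body (head-occ {r = r} rr r∈ v∈ ox)
      where
      from-body : ∀ {x} → (∃₂ λ q u → BodyOcc r x q u) → Built P (σ x)
      from-body (_ , u , occurs {b} {j} b∈ equ ox) =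
        built-occ σ (argTerm-flat d₁ r∈ (there b∈) u∈)
          (All.lookup (All.lookup hs (∈-map⁺ (subA σ) b∈)) (∈-subL⁺ σ u∈)) ox
        where
        u∈ : u ∈ args b
        u∈ = nth-∈ (args b) j equ

instancesOver : List Term → Term → List Term
instancesOver S (var x)    = []
instancesOver S (con c)    = con c ∷ []
instancesOver S (app f ts) = map (app f) (choices (replicate (length ts) S))

termsBelow : Program → ℕ → List Term
termsBelow P zero    = []
termsBelow P (suc d) = concatMap (instancesOver (termsBelow P d)) (termsOf P)

built⇒∈-termsBelow : ∀ {P} d {t} → Built P t → height t < d → t ∈ termsBelow P d
built⇒∈-termsBelow (suc d) (bcon tm) _ = ∈-concatMap⁺ _ (lose (TermOf⇒∈ tm) (here refl))
built⇒∈-termsBelow {P} (suc d) (bapp {f} {us} {ts} tm len bts) (s≤s h) =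
  ∈-concatMap⁺ _ (lose (TermOf⇒∈ tm) (∈-map⁺ (app f)
    (subst (λ n → ts ∈ choices (replicate n (termsBelow P d))) (sym len)
      (∈-choices-replicate (All.tabulate λ t∈ →
        built⇒∈-termsBelow d (All.lookup bts t∈) (≤-<-trans (height-∈ t∈) h))))))

universe : Program → List Term
universe P = termsBelow P (suc (heightBound P))

no-bad-cycle⇒∈-universe : ∀ P → RangeRestricted P → AtMostOneComplex P → DepthAtMostOne P → ∀ {a t} i → M P a →
                          nth (args a) i ≡ just t → ¬ DependsOnBadCycle P (position a i) → t ∈ universe P
no-bad-cycle⇒∈-universe P rr oc d₁ i m eq ok =
  built⇒∈-termsBelow _ (All.lookup (M⇒Built P rr d₁ m) (nth-∈ _ i eq)) (s≤s (no-bad-cycle⇒height P rr oc d₁ i m eq ok))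

-- Finitely many rule instances

mutual
  -- Forgetting the ordering leaves a derivation, so one bound on `M` serves all orderings.
  Inst⇒M : ∀ {P ord g} → Inst P ord g → M P (head g)
  Inst⇒M (add σ r∈ gσ is) = derive σ r∈ gσ (Insts⇒M is)

  Insts⇒M : ∀ {P ord n bs} → All (λ b → ∃[ g ] (Inst P ord g × head g ≡ b × ord (psym b) ≤ n)) bs → All (M P) bs
  Insts⇒M [] = []
  Insts⇒M ((_ , i , refl , _) ∷ is) = Inst⇒M i ∷ Insts⇒M is

atomsOver : List Term → Atom → List Atom
atomsOver S a = map (atom (pred a)) (choices (map (λ _ → S) (args a)))

subA-∈-atomsOver : ∀ {S} σ a → (∀ {t} → t ∈ args (subA σ a) → t ∈ S) → subA σ a ∈ atomsOver S a
subA-∈-atomsOver {S} σ a h = ∈-map⁺ (atom (pred a))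
  (subst (_∈ choices (map (λ _ → S) (args a))) (sym (subL≡map σ (args a)))
    (∈-choices-map (subT σ) (λ _ → S) (args a) (λ t∈ → h (∈-subL⁺ σ t∈))))

-- Atoms are enumerated instead of substitutions, of which there are infinitely many. Repeated
-- variables may be filled inconsistently, since only a finite superset is wanted.
rulesOver : List Term → Rule → List Rule
rulesOver S r = cartesianProductWith _⇐_ (atomsOver S (head r)) (choices (map (atomsOver S) (body r)))

M⇒IsArg : ∀ {P a t} i → M P a → nth (args a) i ≡ just t → IsArg P (position a i)
M⇒IsArg i (derive {r} σ r∈ _ _) eq =
  r , (r∈ , head r , here refl , cong (pred (head r) ,_) (sym (length-subL σ (args (head r))))) ,
  nth-< (subL σ (args (head r))) i eq

ΓAcyclic⇒args∈universe : ∀ P → RangeRestricted P → AtMostOneComplex P → DepthAtMostOne P → ΓAcyclic P →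
                         ∀ {a t} → M P a → t ∈ args a → t ∈ universe P
ΓAcyclic⇒args∈universe P rr oc d₁ acyclic m t∈ with i , eq ← ∈-nth t∈ =
  no-bad-cycle⇒∈-universe P rr oc d₁ i m eq (proj₂ (acyclic _ (M⇒IsArg i m eq)))

theorem1 : (P : Program) → RangeRestricted P → AtMostOneComplex P → DepthAtMostOne P →
    ((a : Arg) → GA P a → Limited P a) × (ΓAcyclic P → FinitelyGround P)
theorem1 P rr oc d₁ = limited , finitelyGround
  where
  limited : (a : Arg) → GA P a → Limited P a
  limited (arg p n i) (_ , ok) =
    universe P , λ { t (b , m , refl , eq) → no-bad-cycle⇒∈-universe P rr oc d₁ i m eq ok }
  finitelyGround : ΓAcyclic P → FinitelyGround P
  finitelyGround acyclic ord _ = concatMap (rulesOver (universe P)) P , λ { _ (add {r} σ r∈ gσ is) →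
    -- Body atoms and head of an added instance all lie in `M`, so their terms lie in `universe P`.
    let ms = Insts⇒M is in
    ∈-concatMap⁺ _ (lose r∈ (∈-cartesianProductWith⁺ _⇐_
      (subA-∈-atomsOver σ (head r) (ΓAcyclic⇒args∈universe P rr oc d₁ acyclic (derive σ r∈ gσ ms)))
      (∈-choices-map (subA σ) (atomsOver (universe P)) (body r) λ {b} b∈ →
        subA-∈-atomsOver σ b (ΓAcyclic⇒args∈universe P rr oc d₁ acyclic (All.lookup ms (∈-map⁺ (subA σ) b∈)))))) }
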